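{- For any centrally L-bounded poset $P$, both $\mathbf 1\oplus P$ and $P\oplus\mathbf 1$ are centrally L-bounded. Furthermore, $\mathbf 1\oplus P\oplus\mathbf 1$ is uniformly L-bounded.
   Context: All posets are finite and nonempty. Let $[n]=\{1,\dots,n\}$; families of subsets of $[n]$ are ordered by inclusion. A poset $(P,\le)$ contains a poset $(P',\le')$ as a (weak) subposet if there is an injection $f:P'\to P$ such that $u\le' v$ implies $f(u)\le f(v)$. A family $\mathcal F\subseteq 2^{[n]}$ is $P$-free if it does not contain $P$ in this sense. $e(P)$ is the maximum integer $k\ge 0$ such that for all integers $n$ and $s$ the family $\binom{[n]}{s}\cup\binom{[n]}{s+1}\cup\cdots\cup\binom{[n]}{s+k-1}$ is $P$-free, where $\binom{[n]}{j}$ is the collection of $j$-element subsets of $[n]$ (empty if $j<0$ or $j>n$). The Lubell function of $\mathcal F\subseteq 2^{[n]}$ is the average over all $n!$ full (maximal) chains $\mathcal C$ of $2^{[n]}$ of $|\mathcal F\cap\mathcal C|$; equivalently $\bar h_n(\mathcal F)=\sum_{F\in\mathcal F}1/\binom{n}{|F|}$. $P$ is uniformly L-bounded if for all $n$, $\bar h_n(\mathcal F)\le e(P)$ for every $P$-free family $\mathcal F\subseteq 2^{[n]}$. $P$ is centrally L-bounded if for all $n$, $\bar h_n(\mathcal F)\le e(P)$ for every $P$-free family $\mathcal F\subseteq 2^{[n]}$ with $\emptyset,[n]\notin\mathcal F$. The ordinal sum $P_1\oplus P_2$ of disjoint posets is the set $P_1\cup P_2$ ordered by $x\le y$ if $x\in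 P_1$ and $y\in P_2$, or if $x,y$ lie in the same $P_i$ with $x\le y$ there. $\mathbf 1$ denotes the one-element poset. -}

module Defs where

open import Data.Fin using (Fin; toℕ)
open import Data.Fin.Properties using (+↔⊎; 1↔⊤)
open import Data.Fin.Subset using (Subset; ∣_∣; ⁅_⁆; _∪_; ⊥; ⊤)
open import Data.Fin.Subset.Properties using (_∈?_; ⊆-poset)
open import Data.Integer as ℤ using (ℤ; +_)
open import Data.List using (List; []; _∷_; allFin; concatMap; filter; length; map)
open import Data.Nat as ℕ using (ℕ; zero; suc; _!)
open import Data.Nat.ListAction using (sum)
open import Data.Nat.Properties using (_!≢0)
open import Data.Product using (Σ; ∃; _×_; proj₁)
open import Data.Rational as ℚ using (ℚ)
open import Data.Sum using (inj₁)
open import Data.Sum.Function.Setoid using (_⊎-inverse_)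
open import Data.Sum.Relation.Binary.LeftOrder using (⊎-<-poset)
open import Data.Sum.Relation.Binary.Pointwise using (Pointwise-≡↔≡)
open import Data.Unit using (tt)
import Data.Unit.Properties as Unit
open import Function.Bundles using (Inverse)
import Function.Construct.Composition as Comp
import Function.Construct.Symmetry as Sym
open import Function.Definitions using (Injective)
open import Level using (0ℓ)
open import Relation.Binary.Bundles using (Poset)
import Relation.Binary.Construct.On as On
open import Relation.Binary.Morphism.Structures using (IsOrderHomomorphism)
open import Relation.Binary.PropositionalEquality using (_≡_; setoid)
open import Relation.Nullary using (¬_; ¬?)
open import Relation.Unary using (Pred; Decidable; ⋃)

record FinPoset : Set₁ where
  field
    poset       : Poset 0ℓ 0ℓ 0ℓ
    size        : ℕ
    enumeration : Inverse (Poset.Eq.setoid poset) (setoid (Fin size))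
    inhabitant  : Poset.Carrier poset

  open Poset poset public

𝟙 : FinPoset
𝟙 = record
  { poset       = Unit.≡-poset
  ; size        = 1
  ; enumeration = Sym.inverse 1↔⊤
  ; inhabitant  = tt
  }

infixr 6 _⊕_

_⊕_ : FinPoset → FinPoset → FinPoset
P ⊕ Q = record
  { poset       = ⊎-<-poset {d = 0ℓ} {0ℓ} {0ℓ} P.poset Q.poset
  ; size        = P.size ℕ.+ Q.size
  ; enumeration = Comp.inverse (P.enumeration ⊎-inverse Q.enumeration)
                    (Comp.inverse (Pointwise-≡↔≡ (Fin P.size) (Fin Q.size))
                                  (Sym.inverse +↔⊎))
  ; inhabitant  = inj₁ P.inhabitant
  }
  where
  module P = FinPoset P
  module Q = FinPoset Q

-- Weak containment: the order on the image may have further relations.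
_ContainsCopyOf_ : Poset 0ℓ 0ℓ 0ℓ → Poset 0ℓ 0ℓ 0ℓ → Set
Q ContainsCopyOf P = Σ (P.Carrier → Q.Carrier) λ f →
  Injective P._≈_ Q._≈_ f × IsOrderHomomorphism P._≈_ Q._≈_ P._≤_ Q._≤_ f
  where
  module P = Poset P
  module Q = Poset Q

Family : ℕ → Set₁
Family n = Pred (Subset n) 0ℓ

-- Members of F are compared by their underlying sets only, so membership
-- proofs do not create duplicate elements.
familyPoset : ∀ {n} → Family n → Poset 0ℓ 0ℓ 0ℓ
familyPoset {n} F = On.poset (⊆-poset n) (proj₁ {B = F})

_Free_ : ∀ {n} → FinPoset → Family n → Set
P Free F = ¬ (familyPoset F ContainsCopyOf FinPoset.poset P)

layer : ∀ n → ℤ → Family n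
layer n j A = + ∣ A ∣ ≡ j

consecutiveLayers : ∀ n → ℤ → ℕ → Family n
consecutiveLayers n s k = ⋃ (Fin k) λ i → layer n (s ℤ.+ + toℕ i)

LayersFree : FinPoset → ℕ → Set
LayersFree P k = ∀ n s → P Free consecutiveLayers n s k

-- e ≡e[ P ] says that the number e(P) is e.
_≡e[_] : ℕ → FinPoset → Set
e ≡e[ P ] = LayersFree P e × (∀ k → LayersFree P k → k ℕ.≤ e)

-- All chains obtained from A by adjoining k further elements one at a time.
chainsFrom : ∀ {n} → ℕ → Subset n → List (List (Subset n))
chainsFrom zero    A = (A ∷ []) ∷ []
chainsFrom (suc k) A =
  concatMap (λ i → map (A ∷_) (chainsFrom k (A ∪ ⁅ i ⁆)))
            (filter (λ i → ¬? (i ∈? A)) (allFin _))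

-- Each of the n! full chains ∅ ⊂ {σ₁} ⊂ {σ₁,σ₂} ⊂ ⋯ ⊂ [n] is listed once.
fullChains : ∀ n → List (List (Subset n))
fullChains n = chainsFrom n ⊥

lubell : ∀ {n} {F : Family n} → Decidable F → ℚ
lubell {n} F? =
  ℚ._/_ (+ sum (map (λ C → length (filter F? C)) (fullChains n))) (n !) {{n !≢0}}

-- Families are decidable because they are finite sets of finite sets.  As e(P)
-- is a maximum rather than a computable expression, "e(P) bounds h" is read as
-- "e(P) exists and bounds h"; the witness e is unique.
UniformlyLBounded : FinPoset → Set₁
UniformlyLBounded P = ∃ λ e → (e ≡e[ P ]) ×
  (∀ n (F : Family n) (F? : Decidable F) → P Free F → lubell F? ℚ.≤ + e ℚ./ 1)

CentrallyLBounded : FinPoset → Set₁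
CentrallyLBounded P = ∃ λ e → (e ≡e[ P ]) ×
  (∀ n (F : Family n) (F? : Decidable F) → P Free F → ¬ F ⊥ → ¬ F ⊤ →
    lubell F? ℚ.≤ + e ℚ./ 1)

{-# OPTIONS --safe #-}

-- Condition on whether ⊥ lies in a family F that is (𝟙 ⊕ P)-free.  If it does,
-- F without ⊥ is P-free, and ⊥ adds exactly one to every chain count.  If not,
-- the average over all full chains is the average over the points i of the
-- averages over the chains through {i}; these are the full chains of a Boolean
-- lattice with one point less, on which F is again (𝟙 ⊕ P)-free.  So adjoining a
-- bottom raises the bound by one and makes the condition ⊥ ∉ F superfluous, and
-- adjoining a top does the same for ⊤.  The layers 1, …, k of [k + 1] have
-- Lubell function k and avoid ⊥ and ⊤, so a bound on the Lubell function also
-- gives the upper bound for e(𝟙 ⊕ P).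

module Submission where

open import Defs
open import Data.Bool using (Bool; true; false; not; if_then_else_)
import Data.Bool as Bool
open import Data.Bool.Properties using (¬-not)
open import Data.Fin using (Fin; zero; suc; toℕ; fromℕ<; punchIn)
open import Data.Fin.Properties using (any?; toℕ-fromℕ<; toℕ<n)
open import Data.Fin.Subset using (Subset; ∣_∣; ⁅_⁆; _∪_; ⊥; ⊤; _⊆_; inside; outside)
open import Data.Fin.Subset.Properties
  using (_∈?_; ⊥⊆; ⊆⊤; ∉⊥; ∪-identityˡ; ∪-identityʳ; drop-∷-⊆; s⊆s; p⊆q⇒∣p∣≤∣q∣; ∣⊥∣≡0; ∣⊤∣≡n)
import Data.Integer as ℤ
import Data.Integer.Properties as ℤ
open import Data.List using (List; []; _∷_; _++_; allFin; concatMap; filter; length; map; tabulate)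
open import Data.List.Properties
  using (concatMap-cong; concatMap-map; map-concatMap; map-cong; map-∘; map-tabulate; map-++; filter-all)
import Data.List.Relation.Unary.All as All
open import Data.Nat using (ℕ; zero; suc; _+_; _*_; _≤_; _<_; z≤n; s≤s; s≤s⁻¹; _!; NonZero)
open import Data.Nat.ListAction using (sum)
open import Data.Nat.ListAction.Properties using (sum-++)
open import Data.Nat.Properties
open import Algebra.Properties.CommutativeMonoid.Sum +-0-commutativeMonoid
  using (sum-syntax; sum-cong-≗; ∑-distrib-+)
open import Data.Nat.Solver using (module +-*-Solver)
open import Data.Product using (∃; _×_; _,_; proj₁; proj₂)
import Data.Rational as ℚ
import Data.Rational.Properties as ℚ
import Data.Rational.Unnormalised as ℚᵘ
import Data.Rational.Unnormalised.Properties as ℚᵘ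
open import Data.Sum using (inj₁; inj₂)
open import Data.Sum.Relation.Binary.LeftOrder using (₁∼₂; ₁∼₁; ₂∼₂)
open import Data.Sum.Relation.Binary.Pointwise using (inj₁; inj₂)
open import Data.Unit using (tt)
import Data.Unit as Unit
open import Data.Vec using ([]; _∷_; here; there; head; tail; insertAt; removeAt; replicate)
open import Data.Vec.Properties using (≡-dec; removeAt-insertAt; ∷-injectiveʳ)
open import Function using (_∘_; case_of_)
open import Function.Definitions using (Injective)
open import Level using (0ℓ)
open import Relation.Binary.Bundles using (Poset)
open import Relation.Binary.Morphism.Structures using (IsOrderHomomorphism)
open import Relation.Binary.PropositionalEquality
open import Relation.Nullary using (¬_; ¬?; does; yes; no; contradiction)
open import Relation.Nullary.Decidable using (_×-dec_)
open import Relation.Unary using (Pred; Decidable)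

-- Sums

∑-const : ∀ n c → ∑[ i < n ] c ≡ n * c
∑-const zero    c = refl
∑-const (suc n) c = cong (c +_) (∑-const n c)

∑-mono-≤ : ∀ {n} {f g : Fin n → ℕ} → (∀ i → f i ≤ g i) → ∑[ i < n ] f i ≤ ∑[ i < n ] g i
∑-mono-≤ {zero}  f≤g = z≤n
∑-mono-≤ {suc n} f≤g = +-mono-≤ (f≤g zero) (∑-mono-≤ (f≤g ∘ suc))

sum-tabulate : ∀ {n} (f : Fin n → ℕ) → sum (tabulate f) ≡ ∑[ i < n ] f i
sum-tabulate {zero}  f = refl
sum-tabulate {suc n} f = cong (f zero +_) (sum-tabulate (f ∘ suc))

sum-map-allFin : ∀ {n} (f : Fin n → ℕ) → sum (map f (allFin n)) ≡ ∑[ i < n ] f i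
sum-map-allFin f = trans (cong sum (map-tabulate (λ i → i) f)) (sum-tabulate f)

sum-map-concatMap : ∀ {A B : Set} (g : B → ℕ) (h : A → List B) xs →
  sum (map g (concatMap h xs)) ≡ sum (map (λ x → sum (map g (h x))) xs)
sum-map-concatMap g h []       = refl
sum-map-concatMap g h (x ∷ xs) = begin
  sum (map g (h x ++ concatMap h xs))             ≡⟨ cong sum (map-++ g (h x) _) ⟩
  sum (map g (h x) ++ map g (concatMap h xs))     ≡⟨ sum-++ (map g (h x)) _ ⟩
  sum (map g (h x)) + sum (map g (concatMap h xs)) ≡⟨ cong (_ +_) (sum-map-concatMap g h xs) ⟩
  _ ∎
  where open ≡-Reasoning

sum-map-+-const : ∀ {A : Set} c (g : A → ℕ) xs →
  sum (map (λ x → c + g x) xs) ≡ length xs * c + sum (map g xs)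
sum-map-+-const c g []       = refl
sum-map-+-const c g (x ∷ xs) = trans (cong (_ +_) (sum-map-+-const c g xs))
  (solve 4 (λ c a l s → (c :+ a) :+ (l :+ s) := (c :+ l) :+ (a :+ s)) refl
     c (g x) (length xs * c) (sum (map g xs)))
  where open +-*-Solver

-- Inserting a point into the ground set

insertAt-replicate : ∀ n (i : Fin (suc n)) (b : Bool) →
  insertAt (replicate n b) i b ≡ replicate (suc n) b
insertAt-replicate n       zero    b = refl
insertAt-replicate (suc n) (suc i) b = cong (b ∷_) (insertAt-replicate n i b)

-- The two sets differ at `i`. Hence removing an end from a family changes nothing on the sections
-- that lead away from that end.
insertAt≢replicate : ∀ {n} (X : Subset n) i {b} → insertAt X i (not b) ≢ replicate (suc n) b
insertAt≢replicate X       zero    {false} ()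
insertAt≢replicate X       zero    {true}  ()
insertAt≢replicate (x ∷ X) (suc i) eq = insertAt≢replicate X i (∷-injectiveʳ eq)

insertAt-injective : ∀ {n} i (b : Bool) → Injective _≡_ _≡_ (λ (X : Subset n) → insertAt X i b)
insertAt-injective i b {X} {Y} eq = begin
  X                           ≡⟨ removeAt-insertAt X i b ⟨
  removeAt (insertAt X i b) i ≡⟨ cong (λ Z → removeAt Z i) eq ⟩
  removeAt (insertAt Y i b) i ≡⟨ removeAt-insertAt Y i b ⟩
  Y                           ∎
  where open ≡-Reasoning

insertAt-mono-⊆ : ∀ {n} i b {X Y : Subset n} → X ⊆ Y → insertAt X i b ⊆ insertAt Y i b
insertAt-mono-⊆ zero    b               X⊆Y = s⊆s X⊆Y
insertAt-mono-⊆ (suc i) b {_ ∷ _} {_ ∷ _} X⊆Y here with here ← X⊆Y here = here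
insertAt-mono-⊆ (suc i) b {_ ∷ _} {_ ∷ _} X⊆Y (there x∈) =
  there (insertAt-mono-⊆ i b (drop-∷-⊆ X⊆Y) x∈)

∣insertAt∣ : ∀ {n} (X : Subset n) i → ∣ insertAt X i inside ∣ ≡ suc ∣ X ∣
∣insertAt∣ X             zero    = refl
∣insertAt∣ (inside  ∷ X) (suc i) = cong suc (∣insertAt∣ X i)
∣insertAt∣ (outside ∷ X) (suc i) = ∣insertAt∣ X i

⊥∪⁅i⁆ : ∀ {n} (i : Fin (suc n)) → ⊥ ∪ ⁅ i ⁆ ≡ insertAt ⊥ i inside
⊥∪⁅i⁆         zero    = cong (inside ∷_) (∪-identityˡ ⊥)
⊥∪⁅i⁆ {suc n} (suc i) = cong (outside ∷_) (⊥∪⁅i⁆ i)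

insertAt-∪-punchIn : ∀ {n} (X : Subset n) i j →
  insertAt X i inside ∪ ⁅ punchIn i j ⁆ ≡ insertAt (X ∪ ⁅ j ⁆) i inside
insertAt-∪-punchIn X       zero    j       = refl
insertAt-∪-punchIn (x ∷ X) (suc i) zero    = cong (_ ∷_)
  (trans (∪-identityʳ _) (cong (λ Z → insertAt Z i inside) (sym (∪-identityʳ X))))
insertAt-∪-punchIn (x ∷ X) (suc i) (suc j) = cong (_ ∷_) (insertAt-∪-punchIn X i j)

-- The list of points outside a set

_∉?_ : ∀ {n} (i : Fin n) (X : Subset n) → _
i ∉? X = ¬? (i ∈? X)

-- Only the Booleans `does` are compared, so the two decision procedures may carry unrelated proofs;
-- for `suc i` in `x ∷ X` and `i` in `X` the Booleans agree by computation.
filter-map : ∀ {A B : Set} {P : Pred A 0ℓ} {Q : Pred B 0ℓ} (P? : Decidable P) (Q? : Decidable Q)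
  (f : A → B) → (∀ x → does (Q? (f x)) ≡ does (P? x)) →
  ∀ xs → filter Q? (map f xs) ≡ map f (filter P? xs)
filter-map P? Q? f eq []       = refl
filter-map P? Q? f eq (x ∷ xs) with does (P? x) | does (Q? (f x)) | eq x
... | true  | .true  | refl = cong (f x ∷_) (filter-map P? Q? f eq xs)
... | false | .false | refl = filter-map P? Q? f eq xs

filter-∉-suc : ∀ {n} x (X : Subset n) →
  filter (_∉? (x ∷ X)) (tabulate suc) ≡ map suc (filter (_∉? X) (allFin n))
filter-∉-suc x X = trans (cong (filter (_∉? (x ∷ X))) (sym (map-tabulate (λ i → i) suc)))
  (filter-map (_∉? X) (_∉? (x ∷ X)) suc (λ _ → refl) (allFin _))

-- `punchIn i` is increasing and skips only `i`, so even the order of enumeration is preserved. This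
-- is why the chain enumerations below agree as lists and not merely up to permutation.
filter-∉-insertAt : ∀ {n} (X : Subset n) i →
  filter (_∉? insertAt X i inside) (allFin (suc n)) ≡ map (punchIn i) (filter (_∉? X) (allFin n))
filter-∉-insertAt X             zero    = filter-∉-suc inside X
filter-∉-insertAt {suc n} (x ∷ X) (suc i) = go x
  where
  open ≡-Reasoning
  shifted : ∀ x → filter (_∉? (x ∷ insertAt X i inside)) (tabulate suc)
                  ≡ map (punchIn (suc i)) (filter (_∉? (x ∷ X)) (tabulate suc))
  shifted x = begin
    filter (_∉? (x ∷ insertAt X i inside)) (tabulate suc)
      ≡⟨ filter-∉-suc x (insertAt X i inside) ⟩
    map suc (filter (_∉? insertAt X i inside) (allFin (suc n)))
      ≡⟨ cong (map suc) (filter-∉-insertAt X i) ⟩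
    map suc (map (punchIn i) (filter (_∉? X) (allFin n)))
      ≡⟨ map-∘ _ ⟨
    map (punchIn (suc i) ∘ suc) (filter (_∉? X) (allFin n))
      ≡⟨ map-∘ _ ⟩
    map (punchIn (suc i)) (map suc (filter (_∉? X) (allFin n)))
      ≡⟨ cong (map (punchIn (suc i))) (filter-∉-suc x X) ⟨
    map (punchIn (suc i)) (filter (_∉? (x ∷ X)) (tabulate suc)) ∎
  go : ∀ x → filter (_∉? (x ∷ insertAt X i inside)) (allFin (suc (suc n)))
             ≡ map (punchIn (suc i)) (filter (_∉? (x ∷ X)) (allFin (suc n)))
  go inside  = shifted inside
  go outside = cong (zero ∷_) (shifted outside)

-- Chain weights

-- The points missing from `insertAt X i inside` correspond, in the same order, to those missing
-- from `X`, so both enumerations branch alike. This makes recursion on the size of the ground set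
-- possible.
chainsFrom-insertAt : ∀ {n} k (X : Subset n) i →
  chainsFrom k (insertAt X i inside) ≡ map (map (λ Y → insertAt Y i inside)) (chainsFrom k X)
chainsFrom-insertAt zero    X i = refl
chainsFrom-insertAt (suc k) X i = begin
  concatMap (λ j → map (ins X ∷_) (chainsFrom k (ins X ∪ ⁅ j ⁆))) (filter (_∉? ins X) (allFin _))
    ≡⟨ cong (concatMap _) (filter-∉-insertAt X i) ⟩
  concatMap (λ j → map (ins X ∷_) (chainsFrom k (ins X ∪ ⁅ j ⁆))) (map (punchIn i) js)
    ≡⟨ concatMap-map _ (punchIn i) js ⟩
  concatMap (λ j → map (ins X ∷_) (chainsFrom k (ins X ∪ ⁅ punchIn i j ⁆))) js
    ≡⟨ concatMap-cong below js ⟩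
  concatMap (λ j → map (map ins) (map (X ∷_) (chainsFrom k (X ∪ ⁅ j ⁆)))) js
    ≡⟨ map-concatMap (map ins) _ js ⟨
  map (map ins) (chainsFrom (suc k) X) ∎
  where
  open ≡-Reasoning
  ins : _ → _
  ins Y = insertAt Y i inside
  js = filter (_∉? X) (allFin _)
  below : ∀ j → map (ins X ∷_) (chainsFrom k (ins X ∪ ⁅ punchIn i j ⁆))
              ≡ map (map ins) (map (X ∷_) (chainsFrom k (X ∪ ⁅ j ⁆)))
  below j = begin
    map (ins X ∷_) (chainsFrom k (ins X ∪ ⁅ punchIn i j ⁆))
      ≡⟨ cong (map (ins X ∷_) ∘ chainsFrom k) (insertAt-∪-punchIn X i j) ⟩
    map (ins X ∷_) (chainsFrom k (ins (X ∪ ⁅ j ⁆)))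
      ≡⟨ cong (map (ins X ∷_)) (chainsFrom-insertAt k (X ∪ ⁅ j ⁆) i) ⟩
    map (ins X ∷_) (map (map ins) (chainsFrom k (X ∪ ⁅ j ⁆)))
      ≡⟨ map-∘ _ ⟨
    map (λ C → ins X ∷ map ins C) (chainsFrom k (X ∪ ⁅ j ⁆))
      ≡⟨ map-∘ _ ⟩
    map (map ins) (map (X ∷_) (chainsFrom k (X ∪ ⁅ j ⁆))) ∎

-- Turns a full chain of the ground set without `i` into the full chain whose first added point is
-- `i`.
extend : ∀ {n} → Fin (suc n) → List (Subset n) → List (Subset (suc n))
extend i C = ⊥ ∷ map (λ X → insertAt X i inside) C

fullChains-suc : ∀ n → fullChains (suc n) ≡
  concatMap (λ i → map (extend i) (fullChains n)) (allFin (suc n))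
fullChains-suc n = trans
  (cong (concatMap step) (filter-all (_∉? ⊥) (All.universal (λ _ → ∉⊥) (allFin (suc n)))))
  (concatMap-cong {f = step} (λ i → begin
    map (⊥ ∷_) (chainsFrom n (⊥ ∪ ⁅ i ⁆))
      ≡⟨ cong (map (⊥ ∷_) ∘ chainsFrom n) (⊥∪⁅i⁆ i) ⟩
    map (⊥ ∷_) (chainsFrom n (insertAt ⊥ i inside))
      ≡⟨ cong (map (⊥ ∷_)) (chainsFrom-insertAt n ⊥ i) ⟩
    map (⊥ ∷_) (map (map (λ X → insertAt X i inside)) (fullChains n))
      ≡⟨ map-∘ (fullChains n) ⟨
    map (extend i) (fullChains n) ∎) (allFin (suc n)))
  where
  open ≡-Reasoning
  step : Fin (suc n) → List (List (Subset (suc n)))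
  step i = map (⊥ ∷_) (chainsFrom n (⊥ ∪ ⁅ i ⁆))

sum-fullChains-suc : ∀ n (g : List (Subset (suc n)) → ℕ) →
  sum (map g (fullChains (suc n))) ≡ ∑[ i < suc n ] sum (map (g ∘ extend i) (fullChains n))
sum-fullChains-suc n g = begin
  sum (map g (fullChains (suc n)))
    ≡⟨ cong (sum ∘ map g) (fullChains-suc n) ⟩
  sum (map g (concatMap (λ i → map (extend i) (fullChains n)) (allFin (suc n))))
    ≡⟨ sum-map-concatMap g (λ i → map (extend i) (fullChains n)) (allFin (suc n)) ⟩
  sum (map (λ i → sum (map g (map (extend i) (fullChains n)))) (allFin (suc n)))
    ≡⟨ sum-map-allFin (λ i → sum (map g (map (extend i) (fullChains n)))) ⟩
  ∑[ i < suc n ] sum (map g (map (extend i) (fullChains n)))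
    ≡⟨ sum-cong-≗ {suc n} (λ i → cong sum (map-∘ {g = g} {f = extend i} (fullChains n))) ⟨
  ∑[ i < suc n ] sum (map (g ∘ extend i) (fullChains n)) ∎
  where open ≡-Reasoning

∑-+-const : ∀ n c (f : Fin n → ℕ) → ∑[ i < n ] (c + f i) ≡ n * c + ∑[ i < n ] f i
∑-+-const n c f = trans (∑-distrib-+ (λ _ → c) f) (cong (_+ sum-syntax n f) (∑-const n c))

-- Σ_C Σ_{X ∈ C} w X over the full chains C: those that begin with the point i are
-- the full chains of the ground set without i.
chainWeight : ∀ n → (Subset n → ℕ) → ℕ
chainWeight zero    w = w []
chainWeight (suc n) w =
  suc n ! * w ⊥ + ∑[ i < suc n ] chainWeight n (λ X → w (insertAt X i inside))

∑-!-+ : ∀ n c (f : Fin (suc n) → ℕ) →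
  ∑[ i < suc n ] (n ! * c + f i) ≡ suc n ! * c + ∑[ i < suc n ] f i
∑-!-+ n c f = trans (∑-+-const (suc n) (n ! * c) f)
  (cong (_+ sum-syntax (suc n) f) (sym (*-assoc (suc n) (n !) c)))

length-fullChains : ∀ n → length (fullChains n) ≡ n !
length-fullChains n = trans (sym (length-sum (fullChains n))) (count n)
  where
  length-sum : ∀ {A : Set} (xs : List A) → sum (map (λ _ → 1) xs) ≡ length xs
  length-sum []       = refl
  length-sum (x ∷ xs) = cong suc (length-sum xs)
  count : ∀ n → sum (map (λ _ → 1) (fullChains n)) ≡ n !
  count zero    = refl
  count (suc n) = trans (sum-fullChains-suc n (λ _ → 1))
    (trans (sum-cong-≗ {suc n} (λ _ → count n)) (∑-const (suc n) (n !)))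

-- Each first point `i` is shared by `n !` chains, and each of these meets `⊥` once; summed over `i`
-- this gives the factor `suc n !` in `chainWeight`.
sum-fullChains : ∀ n (w : Subset n → ℕ) →
  sum (map (λ C → sum (map w C)) (fullChains n)) ≡ chainWeight n w
sum-fullChains zero    w = trans (+-identityʳ _) (+-identityʳ _)
sum-fullChains (suc n) w = begin
  sum (map (λ C → sum (map w C)) (fullChains (suc n)))
    ≡⟨ sum-fullChains-suc n (λ C → sum (map w C)) ⟩
  ∑[ i < suc n ] sum (map (λ C → w ⊥ + sum (map w (map (ins i) C))) (fullChains n))
    ≡⟨ sum-cong-≗ {suc n} (λ i → begin
         sum (map (λ C → w ⊥ + sum (map w (map (ins i) C))) (fullChains n))
           ≡⟨ sum-map-+-const (w ⊥) (λ C → sum (map w (map (ins i) C))) (fullChains n) ⟩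
         length (fullChains n) * w ⊥ + sum (map (λ C → sum (map w (map (ins i) C))) (fullChains n))
           ≡⟨ cong₂ _+_ (cong (_* w ⊥) (length-fullChains n))
                (trans (cong sum (map-cong (λ C → cong sum (sym (map-∘ C))) (fullChains n)))
                       (sum-fullChains n (w ∘ ins i))) ⟩
         n ! * w ⊥ + chainWeight n (w ∘ ins i) ∎) ⟩
  ∑[ i < suc n ] (n ! * w ⊥ + chainWeight n (w ∘ ins i))
    ≡⟨ ∑-!-+ n (w ⊥) (λ i → chainWeight n (w ∘ ins i)) ⟩
  chainWeight (suc n) w ∎
  where
  open ≡-Reasoning
  ins : Fin (suc n) → Subset n → Subset (suc n)
  ins i X = insertAt X i inside

chainWeight-cong : ∀ n {v w : Subset n → ℕ} → v ≗ w → chainWeight n v ≡ chainWeight n w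
chainWeight-cong zero    v≗w = v≗w []
chainWeight-cong (suc n) v≗w = cong₂ _+_ (cong (suc n ! *_) (v≗w ⊥))
  (sum-cong-≗ {suc n} (λ i → chainWeight-cong n (λ X → v≗w (insertAt X i inside))))

-- Φ is an arbitrary functional of the insertion map so that a common first
-- coordinate can be absorbed into it in the induction.
∑-insertAt-comm : ∀ n (x y : Bool) (Φ : (Subset n → Subset (2 + n)) → ℕ) →
  (∀ {f g} → f ≗ g → Φ f ≡ Φ g) →
  ∑[ i < 2 + n ] ∑[ j < 1 + n ] Φ (λ X → insertAt (insertAt X j y) i x) ≡
  ∑[ i < 2 + n ] ∑[ j < 1 + n ] Φ (λ X → insertAt (insertAt X j x) i y)
∑-insertAt-comm n x y Φ Φ-cong = begin
  -- Split by which insertion lands in position zero: the outer one gives `α x y`, the inner one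
  -- `α y x`, and exchanging `x` and `y` swaps these two. The terms with neither are left to `rest`.
  α x y + ∑[ i < suc n ] (Φ (λ X → y ∷ insertAt X i x) + inner x y i)
    ≡⟨ cong (α x y +_) (∑-distrib-+ (λ i → Φ (λ X → y ∷ insertAt X i x)) (inner x y)) ⟩
  α x y + (α y x + ∑[ i < suc n ] inner x y i)
    ≡⟨ solve 3 (λ a b c → a :+ (b :+ c) := b :+ (a :+ c)) refl
         (α x y) (α y x) (sum-syntax (suc n) (inner x y)) ⟩
  α y x + (α x y + ∑[ i < suc n ] inner x y i)
    ≡⟨ cong (λ s → α y x + (α x y + s)) (rest n Φ Φ-cong) ⟩
  α y x + (α x y + ∑[ i < suc n ] inner y x i)
    ≡⟨ cong (α y x +_) (∑-distrib-+ (λ i → Φ (λ X → x ∷ insertAt X i y)) (inner y x)) ⟨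
  α y x + ∑[ i < suc n ] (Φ (λ X → x ∷ insertAt X i y) + inner y x i) ∎
  where
  open ≡-Reasoning
  open +-*-Solver
  α : Bool → Bool → ℕ
  α x y = ∑[ j < suc n ] Φ (λ X → x ∷ insertAt X j y)
  inner : Bool → Bool → Fin (suc n) → ℕ
  inner x y i = ∑[ j < n ] Φ (λ X → insertAt (insertAt X (suc j) y) (suc i) x)
  rest : ∀ n (Φ : (Subset n → Subset (2 + n)) → ℕ) → (∀ {f g} → f ≗ g → Φ f ≡ Φ g) →
    ∑[ i < suc n ] ∑[ j < n ] Φ (λ X → insertAt (insertAt X (suc j) y) (suc i) x) ≡
    ∑[ i < suc n ] ∑[ j < n ] Φ (λ X → insertAt (insertAt X (suc j) x) (suc i) y)
  rest zero    Φ Φ-cong = refl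
  rest (suc n) Φ Φ-cong = begin
    ∑[ i < 2 + n ] ∑[ j < 1 + n ] Φ (double x y i j)
      -- `insertAt X (suc j) y` computes only when `X` is a cons cell, so this equation of insertion
      -- maps is pointwise, and `Φ-cong` stands in for function extensionality.
      ≡⟨ sum-cong-≗ {2 + n} (λ i → sum-cong-≗ {1 + n} (λ j → Φ-cong (double-∷ x y i j))) ⟩
    ∑[ i < 2 + n ] ∑[ j < 1 + n ] Φ (λ X → head X ∷ insertAt (insertAt (tail X) j y) i x)
      ≡⟨ ∑-insertAt-comm n x y (λ θ → Φ (λ X → head X ∷ θ (tail X)))
           (λ f≗g → Φ-cong (λ X → cong (head X ∷_) (f≗g (tail X)))) ⟩
    ∑[ i < 2 + n ] ∑[ j < 1 + n ] Φ (λ X → head X ∷ insertAt (insertAt (tail X) j x) i y)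
      ≡⟨ sum-cong-≗ {2 + n} (λ i → sum-cong-≗ {1 + n} (λ j → Φ-cong (double-∷ y x i j))) ⟨
    ∑[ i < 2 + n ] ∑[ j < 1 + n ] Φ (double y x i j) ∎
    where
    double : Bool → Bool → Fin (2 + n) → Fin (1 + n) → Subset (1 + n) → Subset (3 + n)
    double x y i j X = insertAt (insertAt X (suc j) y) (suc i) x
    double-∷ : ∀ x y i j → double x y i j ≗ λ X → head X ∷ insertAt (insertAt (tail X) j y) i x
    double-∷ x y i j (_ ∷ _) = refl

-- The mirror image of the recursion defining `chainWeight`: chains are sorted by the last point
-- added. In the induction each section at a first point is split by its last point, and then the
-- order of these two choices is exchanged.
chainWeight-top : ∀ n (w : Subset (suc n) → ℕ) →
  chainWeight (suc n) w ≡
  suc n ! * w ⊤ + ∑[ i < suc n ] chainWeight n (λ X → w (insertAt X i outside))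
chainWeight-top zero    w =
  solve 2 (λ a b → con 1 :* a :+ (b :+ con 0) := con 1 :* b :+ (a :+ con 0)) refl (w ⊥) (w ⊤)
  where open +-*-Solver
chainWeight-top (suc n) w = begin
  2+n! * w ⊥ + ∑[ i < 2 + n ] chainWeight (suc n) (λ X → w (insertAt X i inside))
    ≡⟨ cong (2+n! * w ⊥ +_) (sum-cong-≗ {2 + n} (λ i →
         trans (chainWeight-top n (λ X → w (insertAt X i inside)))
               (cong (λ Z → suc n ! * w Z + inner inside outside i) (insertAt-replicate (suc n) i inside)))) ⟩
  2+n! * w ⊥ + ∑[ i < 2 + n ] (suc n ! * w ⊤ + inner inside outside i)
    ≡⟨ cong (2+n! * w ⊥ +_) (∑-!-+ (suc n) (w ⊤) (inner inside outside)) ⟩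
  2+n! * w ⊥ + (2+n! * w ⊤ + ∑[ i < 2 + n ] inner inside outside i)
    ≡⟨ cong (λ s → 2+n! * w ⊥ + (2+n! * w ⊤ + s))
         (∑-insertAt-comm n inside outside (λ θ → chainWeight n (w ∘ θ))
            (λ f≗g → chainWeight-cong n (cong w ∘ f≗g))) ⟩
  2+n! * w ⊥ + (2+n! * w ⊤ + ∑[ i < 2 + n ] inner outside inside i)
    ≡⟨ solve 3 (λ a b c → a :+ (b :+ c) := b :+ (a :+ c)) refl
         (2+n! * w ⊥) (2+n! * w ⊤) (sum-syntax (2 + n) (inner outside inside)) ⟩
  2+n! * w ⊤ + (2+n! * w ⊥ + ∑[ i < 2 + n ] inner outside inside i)
    ≡⟨ cong (2+n! * w ⊤ +_) (∑-!-+ (suc n) (w ⊥) (inner outside inside)) ⟨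
  2+n! * w ⊤ + ∑[ i < 2 + n ] (suc n ! * w ⊥ + inner outside inside i)
    ≡⟨ cong (2+n! * w ⊤ +_) (sum-cong-≗ {2 + n} (λ i →
         cong (λ Z → suc n ! * w Z + inner outside inside i) (insertAt-replicate (suc n) i outside))) ⟨
  2+n! * w ⊤ + ∑[ i < 2 + n ] chainWeight (suc n) (λ X → w (insertAt X i outside)) ∎
  where
  open ≡-Reasoning
  open +-*-Solver
  2+n! = suc (suc n) !
  inner : Bool → Bool → Fin (2 + n) → ℕ
  inner x y i = ∑[ j < 1 + n ] chainWeight n (λ X → w (insertAt (insertAt X j y) i x))

-- One form for both ends, so that adjoining a bottom and adjoining a top share a single proof.
chainWeight-end : ∀ n (b : Bool) (w : Subset (suc n) → ℕ) →
  chainWeight (suc n) w ≡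
  suc n ! * w (replicate (suc n) b) + ∑[ i < suc n ] chainWeight n (λ X → w (insertAt X i (not b)))
chainWeight-end n outside w = refl
chainWeight-end n inside  w = chainWeight-top n w

-- Copies of posets

∣∣-mono-< : ∀ {n} {X Y : Subset n} → X ⊆ Y → X ≢ Y → ∣ X ∣ < ∣ Y ∣
∣∣-mono-< {X = []}          {[]}          X⊆Y X≢Y = contradiction refl X≢Y
∣∣-mono-< {X = inside  ∷ X} {inside  ∷ Y} X⊆Y X≢Y =
  s≤s (∣∣-mono-< (drop-∷-⊆ X⊆Y) (X≢Y ∘ cong (inside ∷_)))
∣∣-mono-< {X = inside  ∷ X} {outside ∷ Y} X⊆Y X≢Y with () ← X⊆Y here
∣∣-mono-< {X = outside ∷ X} {inside  ∷ Y} X⊆Y X≢Y = s≤s (p⊆q⇒∣p∣≤∣q∣ (drop-∷-⊆ X⊆Y))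
∣∣-mono-< {X = outside ∷ X} {outside ∷ Y} X⊆Y X≢Y =
  ∣∣-mono-< (drop-∷-⊆ X⊆Y) (X≢Y ∘ cong (outside ∷_))

copy-map : ∀ {m n} {F : Family m} {G : Family n} {P : Poset 0ℓ 0ℓ 0ℓ} (h : Subset m → Subset n) →
  Injective _≡_ _≡_ h → (∀ {X Y} → X ⊆ Y → h X ⊆ h Y) → (∀ {X} → F X → G (h X)) →
  familyPoset F ContainsCopyOf P → familyPoset G ContainsCopyOf P
copy-map h h-injective h-mono F⇒G (f , f-injective , f-hom) =
  (λ p → h (proj₁ (f p)) , F⇒G (proj₂ (f p))) ,
  f-injective ∘ h-injective ,
  record
    { cong = λ p≈q → cong h (IsOrderHomomorphism.cong f-hom p≈q)
    ; mono = λ p≤q → h-mono (IsOrderHomomorphism.mono f-hom p≤q)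
    }

-- Used to pass from a copy of `𝟙 ⊕ P` or `P ⊕ 𝟙` in `suc e` layers to a copy of `P` in `e` of them.
copy-restrict : ∀ {n} {F G : Family n} {P Q : Poset 0ℓ 0ℓ 0ℓ}
  (cF : familyPoset F ContainsCopyOf Q) (cQ : Q ContainsCopyOf P) →
  (∀ p → G (proj₁ (proj₁ cF (proj₁ cQ p)))) → familyPoset G ContainsCopyOf P
copy-restrict (f , f-injective , f-hom) (g , g-injective , g-hom) inG =
  (λ p → proj₁ (f (g p)) , inG p) ,
  g-injective ∘ f-injective ,
  record
    { cong = λ p≈q → IsOrderHomomorphism.cong f-hom (IsOrderHomomorphism.cong g-hom p≈q)
    ; mono = λ p≤q → IsOrderHomomorphism.mono f-hom (IsOrderHomomorphism.mono g-hom p≤q)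
    }

inj₁-copy : ∀ P Q → FinPoset.poset (P ⊕ Q) ContainsCopyOf FinPoset.poset P
inj₁-copy P Q = inj₁ , (λ { (inj₁ p≈q) → p≈q }) , record { cong = inj₁ ; mono = ₁∼₁ }

inj₂-copy : ∀ P Q → FinPoset.poset (P ⊕ Q) ContainsCopyOf FinPoset.poset Q
inj₂-copy P Q = inj₂ , (λ { (inj₂ p≈q) → p≈q }) , record { cong = inj₂ ; mono = ₂∼₂ }

_∖_ : ∀ {n} → Family n → Subset n → Family n
(F ∖ A) X = F X × X ≢ A

-- The end labelled a is ⊥ for a = outside and ⊤ for a = inside.
Adjoins : Bool → FinPoset → FinPoset → Set₁
Adjoins a P Q = ∀ {n} {F : Family n} → F (replicate n a) →
  familyPoset (F ∖ replicate n a) ContainsCopyOf FinPoset.poset P →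
  familyPoset F ContainsCopyOf FinPoset.poset Q

-- The new bottom goes to `⊥`. The extended map is injective because the family holding the copy of
-- `P` has lost `⊥`.
adjoin-⊥ : ∀ P → Adjoins outside P (𝟙 ⊕ P)
adjoin-⊥ P {n} {F} F⊥ (f , f-injective , f-hom) =
  g ,
  (λ { {inj₁ _} {inj₁ _} _   → inj₁ refl
     ; {inj₁ _} {inj₂ q} eq  → contradiction (sym eq) (proj₂ (proj₂ (f q)))
     ; {inj₂ p} {inj₁ _} eq  → contradiction eq (proj₂ (proj₂ (f p)))
     ; {inj₂ p} {inj₂ q} eq  → inj₂ (f-injective eq) }) ,
  record
    { cong = λ { (inj₁ _) → refl ; (inj₂ p≈q) → IsOrderHomomorphism.cong f-hom p≈q }
    ; mono = λ { ₁∼₂ → ⊥⊆ ; (₁∼₁ _) → λ x∈ → x∈ ; (₂∼₂ p≤q) → IsOrderHomomorphism.mono f-hom p≤q }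
    }
  where
  g : FinPoset.Carrier (𝟙 ⊕ P) → ∃ F
  g (inj₁ _) = ⊥ , F⊥
  g (inj₂ p) = proj₁ (f p) , proj₁ (proj₂ (f p))

adjoin-⊤ : ∀ P → Adjoins inside P (P ⊕ 𝟙)
adjoin-⊤ P {n} {F} F⊤ (f , f-injective , f-hom) =
  g ,
  (λ { {inj₂ _} {inj₂ _} _   → inj₂ refl
     ; {inj₂ _} {inj₁ q} eq  → contradiction (sym eq) (proj₂ (proj₂ (f q)))
     ; {inj₁ p} {inj₂ _} eq  → contradiction eq (proj₂ (proj₂ (f p)))
     ; {inj₁ p} {inj₁ q} eq  → inj₁ (f-injective eq) }) ,
  record
    { cong = λ { (inj₂ _) → refl ; (inj₁ p≈q) → IsOrderHomomorphism.cong f-hom p≈q }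
    ; mono = λ { ₁∼₂ → ⊆⊤ ; (₂∼₂ _) → λ x∈ → x∈ ; (₁∼₁ p≤q) → IsOrderHomomorphism.mono f-hom p≤q }
    }
  where
  g : FinPoset.Carrier (P ⊕ 𝟙) → ∃ F
  g (inj₂ _) = ⊤ , F⊤
  g (inj₁ p) = proj₁ (f p) , proj₁ (proj₂ (f p))

-- Consecutive layers

layer-< : ∀ {n k l} {s : ℤ.ℤ} {X Y : Subset n} →
  layer n (s ℤ.+ ℤ.+ k) X → layer n (s ℤ.+ ℤ.+ l) Y → X ⊆ Y → X ≢ Y → k < l
layer-< {s = s} X∈ Y∈ X⊆Y X≢Y = ≰⇒> λ l≤k →
  ℤ.<⇒≱ (subst₂ ℤ._<_ X∈ Y∈ (ℤ.+<+ (∣∣-mono-< X⊆Y X≢Y))) (ℤ.+-monoʳ-≤ s (ℤ.+≤+ l≤k))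

-- In a copy of `𝟙 ⊕ P` every image of `P` lies strictly above the image of the bottom, so it misses
-- the lowest layer; what remains is a copy of `P` in the upper `e` layers.
layersFree-𝟙⊕ : ∀ P e → LayersFree P e → LayersFree (𝟙 ⊕ P) (suc e)
layersFree-𝟙⊕ P e free n s c@(f , f-injective , f-hom) =
  free n (s ℤ.+ ℤ.+ 1)
    (copy-restrict {P = FinPoset.poset P} {FinPoset.poset (𝟙 ⊕ P)} c (inj₂-copy 𝟙 P) λ p →
    raise {proj₁ (f (inj₂ p))} (proj₂ (f (inj₂ p))) (above-bottom p))
  where
  raise : ∀ {X j} (X∈ : consecutiveLayers n s (suc e) X) → j < toℕ (proj₁ X∈) →
    consecutiveLayers n (s ℤ.+ ℤ.+ 1) e X
  -- Index zero is excluded by `j < toℕ (proj₁ X∈)`.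
  raise (suc i , eq) _ = i , trans eq (sym (ℤ.+-assoc s (ℤ.+ 1) (ℤ.+ toℕ i)))
  above-bottom : ∀ p → toℕ (proj₁ (proj₂ (f (inj₁ tt)))) < toℕ (proj₁ (proj₂ (f (inj₂ p))))
  above-bottom p = layer-< {s = s} (proj₂ (proj₂ (f (inj₁ tt)))) (proj₂ (proj₂ (f (inj₂ p))))
    (IsOrderHomomorphism.mono f-hom ₁∼₂)
    (λ eq → case f-injective {inj₁ tt} {inj₂ p} eq of λ ())

layersFree-⊕𝟙 : ∀ P e → LayersFree P e → LayersFree (P ⊕ 𝟙) (suc e)
layersFree-⊕𝟙 P e free n s c@(f , f-injective , f-hom) =
  free n s (copy-restrict {P = FinPoset.poset P} {FinPoset.poset (P ⊕ 𝟙)} c (inj₁-copy P 𝟙) λ p →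
    lower {proj₁ (f (inj₁ p))} (proj₂ (f (inj₁ p)))
      -- The layer index of the top is below `suc e`, hence at most `e`, which puts every other
      -- index strictly below `e`.
      (<-≤-trans (below-top p) (s≤s⁻¹ (toℕ<n (proj₁ (proj₂ (f (inj₂ tt))))))))
  where
  lower : ∀ {X} (X∈ : consecutiveLayers n s (suc e) X) → toℕ (proj₁ X∈) < e →
    consecutiveLayers n s e X
  lower (i , eq) i<e = fromℕ< i<e , trans eq (cong (λ k → s ℤ.+ ℤ.+ k) (sym (toℕ-fromℕ< i<e)))
  below-top : ∀ p → toℕ (proj₁ (proj₂ (f (inj₁ p)))) < toℕ (proj₁ (proj₂ (f (inj₂ tt))))
  below-top p = layer-< {s = s} (proj₂ (proj₂ (f (inj₁ p)))) (proj₂ (proj₂ (f (inj₂ tt))))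
    (IsOrderHomomorphism.mono f-hom ₁∼₂)
    (λ eq → case f-injective {inj₁ p} {inj₂ tt} eq of λ ())

-- Bounds on the number of incidences with full chains

indicator : ∀ {n} {F : Family n} → Decidable F → Subset n → ℕ
indicator F? X = if does (F? X) then 1 else 0

indicator-∈ : ∀ {n} {F : Family n} (F? : Decidable F) {X} → F X → indicator F? X ≡ 1
indicator-∈ F? {X} X∈F with F? X
... | yes _   = refl
... | no  X∉F = contradiction X∈F X∉F

indicator-∉ : ∀ {n} {F : Family n} (F? : Decidable F) {X} → ¬ F X → indicator F? X ≡ 0
indicator-∉ F? {X} X∉F with F? X
... | yes X∈F = contradiction X∈F X∉F
... | no  _   = refl

_≟ˢ_ : ∀ {n} (X Y : Subset n) → _
_≟ˢ_ = ≡-dec Bool._≟_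

_∖?_ : ∀ {n} {F : Family n} → Decidable F → (A : Subset n) → Decidable (F ∖ A)
(F? ∖? A) X = F? X ×-dec ¬? (X ≟ˢ A)

indicator-∖ : ∀ {n} {F : Family n} (F? : Decidable F) {A X} → X ≢ A →
  indicator F? X ≡ indicator (F? ∖? A) X
indicator-∖ F? {A} {X} X≢A with F? X | X ≟ˢ A
... | _     | yes X≡A = contradiction X≡A X≢A
... | yes _ | no  _   = refl
... | no  _ | no  _   = refl

length-filter-indicator : ∀ {n} {F : Family n} (F? : Decidable F) C →
  length (filter F? C) ≡ sum (map (indicator F?) C)
length-filter-indicator F? []      = refl
length-filter-indicator F? (X ∷ C) with does (F? X)
... | true  = cong suc (length-filter-indicator F? C)
... | false = length-filter-indicator F? C

-- C selects which of the two ends must be missing from the family.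
Bounded : (Bool → Set) → FinPoset → ℕ → Set₁
Bounded C P e = ∀ n (F : Family n) (F? : Decidable F) → P Free F →
  (∀ b → C b → ¬ F (replicate n b)) → chainWeight n (indicator F?) ≤ e * n !

-- Even when `F` misses the end labelled `a`, its sections may contain their own end with that
-- label. The induction on `n` therefore needs a conclusion that asks nothing at `a`.
adjoin-bounded : ∀ {C P Q e} a → Adjoins a P Q → Bounded C P e →
  Bounded (λ b → C b × b ≢ a) Q (suc e)
adjoin-bounded {e = e} a adjoin bounded zero F F? Q-free ends with does (F? [])
... | true  = s≤s z≤n
... | false = z≤n
adjoin-bounded {C} {P} {Q} {e} a adjoin bounded (suc n) F F? Q-free ends
  with F? (replicate (suc n) a)
... | no a∉F = begin
  chainWeight (suc n) (indicator F?)
    ≡⟨ chainWeight-end n a (indicator F?) ⟩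
  suc n ! * indicator F? (replicate (suc n) a) + ∑[ i < suc n ] section i
    ≡⟨ cong (λ t → suc n ! * t + sum-syntax (suc n) section) (indicator-∉ F? a∉F) ⟩
  suc n ! * 0 + ∑[ i < suc n ] section i
    ≡⟨ cong (_+ sum-syntax (suc n) section) (*-zeroʳ (suc n !)) ⟩
  ∑[ i < suc n ] section i
    ≤⟨ ∑-mono-≤ section-≤ ⟩
  ∑[ i < suc n ] (suc e * n !)
    ≡⟨ ∑-const (suc n) (suc e * n !) ⟩
  suc n * (suc e * n !)
    ≡⟨ solve 3 (λ m e f → m :* (e :* f) := e :* (m :* f)) refl (suc n) (suc e) (n !) ⟩
  suc e * suc n ! ∎
  where
  open ≤-Reasoning
  open +-*-Solver
  ins : Fin (suc n) → Subset n → Subset (suc n)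
  ins i X = insertAt X i (not a)
  section : Fin (suc n) → ℕ
  section i = chainWeight n (indicator F? ∘ ins i)
  section-≤ : ∀ i → section i ≤ suc e * n !
  section-≤ i = adjoin-bounded {C} {P} {Q} {e} a adjoin bounded n (F ∘ ins i) (F? ∘ ins i)
    (Q-free ∘ copy-map {P = FinPoset.poset Q} (ins i) (insertAt-injective i (not a))
                (insertAt-mono-⊆ i (not a)) (λ X∈F → X∈F))
    ends′
    where
    ends′ : ∀ b → C b × b ≢ a → ¬ F (ins i (replicate n b))
    -- Only `b = not a` is left, and inserting `not a` into that end gives the same end of the
    -- larger lattice.
    ends′ b (Cb , b≢a) b∈F with refl ← ¬-not b≢a =
      ends b (Cb , b≢a) (subst F (insertAt-replicate n i b) b∈F)
... | yes a∈F = begin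
  chainWeight (suc n) (indicator F?)
    ≡⟨ chainWeight-end n a (indicator F?) ⟩
  suc n ! * indicator F? end + ∑[ i < suc n ] section F? i
    ≡⟨ cong₂ (λ t u → suc n ! * t + u) (indicator-∈ F? a∈F)
         (sum-cong-≗ {suc n} (λ i → chainWeight-cong n (λ X → indicator-∖ F? (insertAt≢replicate X i {a})))) ⟩
  suc n ! * 1 + ∑[ i < suc n ] section F∖? i
    -- The term for the deleted end is put back so that `chainWeight-end` can be read backwards; an
    -- inequality suffices.
    ≤⟨ +-mono-≤ (≤-reflexive (*-identityʳ (suc n !))) (m≤n+m _ (suc n ! * indicator F∖? end)) ⟩
  suc n ! + (suc n ! * indicator F∖? end + ∑[ i < suc n ] section F∖? i)
    ≡⟨ cong (suc n ! +_) (chainWeight-end n a (indicator F∖?)) ⟨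
  suc n ! + chainWeight (suc n) (indicator F∖?)
    ≤⟨ +-monoʳ-≤ (suc n !) (bounded (suc n) (F ∖ end) F∖? (Q-free ∘ adjoin a∈F) ends′) ⟩
  suc e * suc n ! ∎
  where
  open ≤-Reasoning
  end = replicate (suc n) a
  F∖? = F? ∖? end
  section : ∀ {G : Family (suc n)} → Decidable G → Fin (suc n) → ℕ
  section G? i = chainWeight n (λ X → indicator G? (insertAt X i (not a)))
  ends′ : ∀ b → C b → ¬ (F ∖ end) (replicate (suc n) b)
  ends′ b Cb (b∈F , b≢end) = ends b (Cb , λ { refl → b≢end refl }) b∈F

-- Every full chain starts with `m` sets of size below `m`, provided it has that many, which is
-- `m ≤ suc n`. `⊥` is one of them, and passing to a section lowers all sizes by one, so `m` and `n`
-- decrease together.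
m*n!≤chainWeight : ∀ m n (w : Subset n → ℕ) → (∀ X → ∣ X ∣ < m → 1 ≤ w X) → m ≤ suc n →
  m * n ! ≤ chainWeight n w
m*n!≤chainWeight zero    n       w low m≤1+n       = z≤n
m*n!≤chainWeight (suc zero) zero w low m≤1+n       = low [] (s≤s z≤n)
m*n!≤chainWeight (suc (suc _)) zero w low (s≤s ())
m*n!≤chainWeight (suc m) (suc n) w low (s≤s m≤1+n) = begin
  suc n ! + m * suc n !
    ≡⟨ cong₂ _+_ (sym (*-identityʳ (suc n !)))
         (solve 3 (λ m k f → m :* (k :* f) := k :* (m :* f)) refl m (suc n) (n !)) ⟩
  suc n ! * 1 + suc n * (m * n !)
    ≡⟨ cong (suc n ! * 1 +_) (∑-const (suc n) (m * n !)) ⟨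
  suc n ! * 1 + ∑[ i < suc n ] (m * n !)
    ≤⟨ +-mono-≤ (*-monoʳ-≤ (suc n !) (low ⊥ (subst (_< suc m) (sym (∣⊥∣≡0 (suc n))) (s≤s z≤n))))
         (∑-mono-≤ (λ i → m*n!≤chainWeight m n (λ X → w (insertAt X i inside))
            (λ X X<m → low _ (subst (_< suc m) (sym (∣insertAt∣ X i)) (s≤s X<m))) m≤1+n)) ⟩
  chainWeight (suc n) w ∎
  where
  open ≤-Reasoning
  open +-*-Solver

bounded⇒maximal : ∀ {C P e} → Bounded C P e → ∀ k → LayersFree P k → k ≤ e
bounded⇒maximal {C} {P} {e} bounded k free = *-cancelʳ-≤ k e (suc k !) {{suc k !≢0}} (begin
  k * suc k !
    ≡⟨ solve 3 (λ m k f → m :* (k :* f) := k :* (m :* f)) refl k (suc k) (k !) ⟩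
  suc k * (k * k !)
    ≡⟨ ∑-const (suc k) (k * k !) ⟨
  ∑[ i < suc k ] (k * k !)
    -- The section at `i` of the layers 1, ..., k consists of the layers 0, ..., k - 1 of a
    -- `k`-point lattice, and every full chain there passes through all `k` of them.
    ≤⟨ ∑-mono-≤ (λ i → m*n!≤chainWeight k k (λ X → indicator F? (insertAt X i inside)) (low i) (n≤1+n k)) ⟩
  ∑[ i < suc k ] chainWeight k (λ X → indicator F? (insertAt X i inside))
    ≤⟨ m≤n+m _ (suc k ! * indicator F? ⊥) ⟩
  chainWeight (suc k) (indicator F?)
    ≤⟨ bounded (suc k) F F? (free (suc k) (ℤ.+ 1)) ends ⟩
  e * suc k ! ∎)
  where
  open ≤-Reasoning
  open +-*-Solver
  F : Family (suc k)
  F = consecutiveLayers (suc k) (ℤ.+ 1) k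
  F? : Decidable F
  F? X = any? (λ i → ℤ.+ ∣ X ∣ ℤ.≟ ℤ.+ 1 ℤ.+ ℤ.+ toℕ i)
  low : ∀ i X → ∣ X ∣ < k → 1 ≤ indicator F? (insertAt X i inside)
  low i X X<k = ≤-reflexive (sym (indicator-∈ F? {insertAt X i inside}
    (fromℕ< X<k , cong ℤ.+_ (trans (∣insertAt∣ X i) (cong suc (sym (toℕ-fromℕ< X<k)))))))
  -- The ends have sizes 0 and `suc k`, just outside the range from 1 to `k`, so any `C` is served.
  ends : ∀ b → C b → ¬ F (replicate (suc k) b)
  ends outside _ (i , eq) with () ← trans (sym (∣⊥∣≡0 (suc k))) (ℤ.+-injective eq)
  ends inside  _ (i , eq) =
    <⇒≢ (toℕ<n i) (sym (suc-injective (trans (sym (∣⊤∣≡n (suc k))) (ℤ.+-injective eq))))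

-- Lubell functions

-- `ℚ._/_` reduces to lowest terms, so the inequality is moved to unnormalised rationals, where
-- cross-multiplication sees the given numerator and denominator.
/≤/1⇒≤* : ∀ a d e .{{_ : NonZero d}} → ℤ.+ a ℚ./ d ℚ.≤ ℤ.+ e ℚ./ 1 → a ≤ e * d
/≤/1⇒≤* a (suc d) e a/d≤e = subst (_≤ e * suc d) (*-identityʳ a) (ℤ.drop‿+≤+
  (subst₂ ℤ._≤_ (sym (ℤ.pos-* a 1)) (sym (ℤ.pos-* e (suc d)))
    (ℚᵘ.drop-*≤* (ℚᵘ.≤-respˡ-≃ (ℚ.toℚᵘ-fromℚᵘ (ℚᵘ.mkℚᵘ (ℤ.+ a) d))
      (ℚᵘ.≤-respʳ-≃ (ℚ.toℚᵘ-fromℚᵘ (ℚᵘ.mkℚᵘ (ℤ.+ e) 0)) (ℚ.toℚᵘ-mono-≤ a/d≤e))))))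

≤*⇒/≤/1 : ∀ a d e .{{_ : NonZero d}} → a ≤ e * d → ℤ.+ a ℚ./ d ℚ.≤ ℤ.+ e ℚ./ 1
≤*⇒/≤/1 a (suc d) e a≤e*d = ℚ.toℚᵘ-cancel-≤
  (ℚᵘ.≤-respˡ-≃ (ℚᵘ.≃-sym (ℚ.toℚᵘ-fromℚᵘ (ℚᵘ.mkℚᵘ (ℤ.+ a) d)))
    (ℚᵘ.≤-respʳ-≃ (ℚᵘ.≃-sym (ℚ.toℚᵘ-fromℚᵘ (ℚᵘ.mkℚᵘ (ℤ.+ e) 0)))
      (ℚᵘ.*≤* (subst₂ ℤ._≤_ (ℤ.pos-* a 1) (ℤ.pos-* e (suc d))
        (ℤ.+≤+ (subst (_≤ e * suc d) (sym (*-identityʳ a)) a≤e*d))))))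

lubell-numerator : ∀ {n} {F : Family n} (F? : Decidable F) →
  sum (map (λ C → length (filter F? C)) (fullChains n)) ≡ chainWeight n (indicator F?)
lubell-numerator {n} F? = trans
  (cong sum (map-cong (length-filter-indicator F?) (fullChains n)))
  (sum-fullChains n (indicator F?))

lubell≤⇒chainWeight≤ : ∀ {n} {F : Family n} (F? : Decidable F) e →
  lubell F? ℚ.≤ ℤ.+ e ℚ./ 1 → chainWeight n (indicator F?) ≤ e * n !
lubell≤⇒chainWeight≤ {n} F? e h≤e = subst (_≤ e * n !) (lubell-numerator F?)
  (/≤/1⇒≤* _ (n !) e {{n !≢0}} h≤e)

chainWeight≤⇒lubell≤ : ∀ {n} {F : Family n} (F? : Decidable F) e →
  chainWeight n (indicator F?) ≤ e * n ! → lubell F? ℚ.≤ ℤ.+ e ℚ./ 1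
chainWeight≤⇒lubell≤ {n} F? e w≤e = ≤*⇒/≤/1 _ (n !) e {{n !≢0}}
  (subst (_≤ e * n !) (sym (lubell-numerator F?)) w≤e)

theorem6p1 : (P : FinPoset) → CentrallyLBounded P →
    CentrallyLBounded (𝟙 ⊕ P) × CentrallyLBounded (P ⊕ 𝟙) × UniformlyLBounded (𝟙 ⊕ P ⊕ 𝟙)
theorem6p1 P (e , (free , _) , lubell≤e) =
  central {Q = 𝟙 ⊕ P} 𝟙⊕P-bounded (layersFree-𝟙⊕ P e free) ,
  central {Q = P ⊕ 𝟙} P⊕𝟙-bounded (layersFree-⊕𝟙 P e free) ,
  suc (suc e) ,
  (layersFree-𝟙⊕ (P ⊕ 𝟙) (suc e) (layersFree-⊕𝟙 P e free) ,
   bounded⇒maximal {P = 𝟙 ⊕ P ⊕ 𝟙} {suc (suc e)} 𝟙⊕P⊕𝟙-bounded) ,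
  λ n F F? F-free → chainWeight≤⇒lubell≤ F? (suc (suc e))
    (𝟙⊕P⊕𝟙-bounded n F F? F-free
      -- Both ends have been adjoined, so no `b` satisfies the remaining condition and the bound
      -- holds for every free family.
      (λ { outside (_ , out≢out) → contradiction refl out≢out
         ; inside ((_ , in≢in) , _) → contradiction refl in≢in }))
  where
  -- Central boundedness of `P` speaks of families missing both ends; each adjunction below lifts
  -- the demand at one end.
  Both : Bool → Set
  Both _ = Unit.⊤

  P-bounded : Bounded Both P e
  P-bounded n F F? F-free ends = lubell≤⇒chainWeight≤ F? e
    (lubell≤e n F F? F-free (ends outside tt) (ends inside tt))

  𝟙⊕P-bounded : Bounded (λ b → Both b × b ≢ outside) (𝟙 ⊕ P) (suc e)
  𝟙⊕P-bounded = adjoin-bounded {Both} {P} {𝟙 ⊕ P} {e} outside (adjoin-⊥ P) P-bounded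

  P⊕𝟙-bounded : Bounded (λ b → Both b × b ≢ inside) (P ⊕ 𝟙) (suc e)
  P⊕𝟙-bounded = adjoin-bounded {Both} {P} {P ⊕ 𝟙} {e} inside (adjoin-⊤ P) P-bounded

  𝟙⊕P⊕𝟙-bounded : Bounded (λ b → (Both b × b ≢ inside) × b ≢ outside) (𝟙 ⊕ P ⊕ 𝟙) (suc (suc e))
  𝟙⊕P⊕𝟙-bounded = adjoin-bounded {λ b → Both b × b ≢ inside} {P ⊕ 𝟙} {𝟙 ⊕ P ⊕ 𝟙} {suc e} outside
    (adjoin-⊥ (P ⊕ 𝟙)) P⊕𝟙-bounded

  central : ∀ {C Q} → Bounded C Q (suc e) → LayersFree Q (suc e) → CentrallyLBounded Q
  central {Q = Q} bounded Q-free = suc e , (Q-free , bounded⇒maximal {P = Q} {suc e} bounded) ,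
    -- A family missing both ends meets whatever `C` demands, so a bound with fewer demands gives
    -- central boundedness.
    λ n F F? F-free ⊥∉F ⊤∉F → chainWeight≤⇒lubell≤ F? (suc e)
      (bounded n F F? F-free (λ { outside _ → ⊥∉F ; inside _ → ⊤∉F }))
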